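{- The Cut Rule \[ \frac{\Gamma_1\Rightarrow \phi \qquad \Gamma_2,\phi \Rightarrow \Delta}{\Gamma_1,\Gamma_2 \Rightarrow \Delta} \] is admissible in the sequent calculus $\mathsf{G3iLL}$; that is, for all finite multisets of formulas $\Gamma_1,\Gamma_2$, every formula $\phi$ and every multiset $\Delta$ containing at most one formula, if $\Gamma_1\Rightarrow\phi$ and $\Gamma_2,\phi\Rightarrow\Delta$ are derivable in $\mathsf{G3iLL}$, then $\Gamma_1,\Gamma_2\Rightarrow\Delta$ is derivable in $\mathsf{G3iLL}$.
   Context: Formulas of the language of propositional Lax Logic are built from the constant $\bot$ and propositional atoms $p,q,\dots$ (with $\bot$ not an atom) using the binary connectives $\wedge,\vee,\to$ and a unary modal operator $\bigcirc$. A sequent is an expression $\Gamma\Rightarrow\Delta$ with $\Gamma,\Delta$ finite multisets of formulas and $\Delta$ containing at most one formula; $\Gamma,\Pi$ denotes multiset union. The calculus $\mathsf{G3iLL}$ has the axioms $\Gamma,p\Rightarrow p$ ($p$ an atom) and $\Gamma,\bot\Rightarrow\Delta$, and the rules (premisses / conclusion): $R\wedge$: $\Gamma\Rightarrow\phi$ and $\Gamma\Rightarrow\psi$ / $\Gamma\Rightarrow\phi\wedge\psi$; $L\wedge$: $\Gamma,\phi,\psi\Rightarrow\Delta$ / $\Gamma,\phi\wedge\psi\Rightarrow\Delta$; $R\vee$: $\Gamma\Rightarrow\phi_i$ / $\Gamma\Rightarrow\phi_0\vee\phi_1$ ($i=0,1$); $L\vee$: $\Gamma,\phi\Rightarrow\Delta$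 and $\Gamma,\psi\Rightarrow\Delta$ / $\Gamma,\phi\vee\psi\Rightarrow\Delta$; $R\to$: $\Gamma,\phi\Rightarrow\psi$ / $\Gamma\Rightarrow\phi\to\psi$; $L\to$: $\Gamma,\phi\to\psi\Rightarrow\phi$ and $\Gamma,\psi\Rightarrow\Delta$ / $\Gamma,\phi\to\psi\Rightarrow\Delta$; $R\bigcirc$: $\Gamma\Rightarrow\phi$ / $\Gamma\Rightarrow\bigcirc\phi$; $L\bigcirc$: $\Gamma,\psi\Rightarrow\bigcirc\phi$ / $\Gamma,\bigcirc\psi\Rightarrow\bigcirc\phi$. -}

module Defs where

open import Data.List using (List; _∷_)
open import Data.List.Relation.Binary.Permutation.Propositional using (_↭_)
open import Data.Maybe using (Maybe; just)
open import Data.Nat using (ℕ)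

infixr 8 _∧_
infixr 7 _∨_
infixr 6 _⊃_
infix  9 ○_

data Formula : Set where
  ⊥ᶠ          : Formula
  atom        : ℕ → Formula
  _∧_ _∨_ _⊃_ : Formula → Formula → Formula
  ○_          : Formula → Formula

-- A finite multiset is represented by a list, read up to permutation: multiset
-- union is _++_, and multiset equality is _↭_.
Multiset : Set
Multiset = List Formula

-- Multisets containing at most one formula; `nothing` is the empty one.
Succedent : Set
Succedent = Maybe Formula

infix 3 ⊢_⇒_

-- Derivations in G3iLL.  An axiom or left rule whose conclusion has antecedent
-- "Γ together with the principal formula" applies to any list Θ representing that
-- multiset, hence the argument Θ ↭ principal ∷ Γ.  Permuting an antecedent is
-- thus not an inference step.  The right rules leave the antecedent unchanged.
data ⊢_⇒_ : Multiset → Succedent → Set where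

  Ax : ∀ {Θ Γ p} → Θ ↭ atom p ∷ Γ →
       ⊢ Θ ⇒ just (atom p)

  L⊥ : ∀ {Θ Γ Δ} → Θ ↭ ⊥ᶠ ∷ Γ →
       ⊢ Θ ⇒ Δ

  R∧ : ∀ {Γ φ ψ} →
       ⊢ Γ ⇒ just φ →
       ⊢ Γ ⇒ just ψ →
       ⊢ Γ ⇒ just (φ ∧ ψ)

  L∧ : ∀ {Θ Γ φ ψ Δ} → Θ ↭ φ ∧ ψ ∷ Γ →
       ⊢ φ ∷ ψ ∷ Γ ⇒ Δ →
       ⊢ Θ ⇒ Δ

  R∨₀ : ∀ {Γ φ ψ} →
        ⊢ Γ ⇒ just φ →
        ⊢ Γ ⇒ just (φ ∨ ψ)

  R∨₁ : ∀ {Γ φ ψ} →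
        ⊢ Γ ⇒ just ψ →
        ⊢ Γ ⇒ just (φ ∨ ψ)

  L∨ : ∀ {Θ Γ φ ψ Δ} → Θ ↭ φ ∨ ψ ∷ Γ →
       ⊢ φ ∷ Γ ⇒ Δ →
       ⊢ ψ ∷ Γ ⇒ Δ →
       ⊢ Θ ⇒ Δ

  R⊃ : ∀ {Γ φ ψ} →
       ⊢ φ ∷ Γ ⇒ just ψ →
       ⊢ Γ ⇒ just (φ ⊃ ψ)

  L⊃ : ∀ {Θ Γ φ ψ Δ} → Θ ↭ φ ⊃ ψ ∷ Γ →
       ⊢ φ ⊃ ψ ∷ Γ ⇒ just φ →
       ⊢ ψ ∷ Γ ⇒ Δ →
       ⊢ Θ ⇒ Δ

  R○ : ∀ {Γ φ} →
       ⊢ Γ ⇒ just φ →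
       ⊢ Γ ⇒ just (○ φ)

  L○ : ∀ {Θ Γ ψ φ} → Θ ↭ ○ ψ ∷ Γ →
       ⊢ ψ ∷ Γ ⇒ just (○ φ) →
       ⊢ Θ ⇒ just (○ φ)

{-# OPTIONS --safe #-}

-- Gentzen's argument, with a multiplicative cut, by lexicographic induction on
-- (cut formula, left derivation, right derivation).  Left rules other than L○
-- ending the left derivation are permuted below the cut first, whatever the right
-- derivation is.  L○ needs a succedent of the form ○ χ, so it is permuted only
-- when the cut formula is principal in the right derivation, where the succedent
-- has that form.
-- Contraction needs no height-preserving inversion: the duplicates left after
-- inverting are smaller formulas.
module Submission where

open import Data.List using (List; []; _∷_; _++_; [_])
open import Data.List.Membership.Propositional.Properties using (∈-∃++)
open import Data.List.Properties using (++-assoc; ++-identityʳ)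
open import Data.List.Relation.Binary.Permutation.Propositional
  using (_↭_; refl; prep; swap; ↭-sym; ↭-trans; ↭-reflexive)
open import Data.List.Relation.Binary.Permutation.Propositional.Properties
  using (∈-resp-↭; drop-∷; shift; shifts; ++-comm; ++⁺ʳ; ++⁺ˡ)
open import Data.List.Relation.Unary.Any using (here; there)
open import Data.Maybe using (just)
open import Data.Product using (_×_; _,_; ∃-syntax)
open import Data.Sum using (_⊎_; inj₁; inj₂)
open import Relation.Binary.PropositionalEquality using (_≡_; refl; sym)
open import Defs

-- The case distinction behind every induction below: with `x` principal and `y` the tracked
-- formula, either they are the same occurrence, or each survives in the other's context.
∷-split : ∀ {a} {A : Set a} {x y : A} {xs ys} → x ∷ xs ↭ y ∷ ys →
  (x ≡ y × xs ↭ ys) ⊎ (∃[ zs ] xs ↭ y ∷ zs × ys ↭ x ∷ zs)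
∷-split {x = x} {y} p with ∈-resp-↭ (↭-sym p) (here refl)
... | here refl = inj₁ (refl , drop-∷ p)
... | there y∈xs with as , bs , refl ← ∈-∃++ y∈xs =
  inj₂ (as ++ bs , shift y as bs ,
        ↭-sym (drop-∷ (↭-trans (swap y x refl) (↭-trans (prep x (↭-sym (shift y as bs))) p))))

-- For contraction: the copies of `y` are interchangeable, so a principal `x` matching either one
-- lands in the same case.
∷∷-split : ∀ {a} {A : Set a} {x y : A} {xs ys} → x ∷ xs ↭ y ∷ y ∷ ys →
  (x ≡ y × xs ↭ y ∷ ys) ⊎ (∃[ zs ] xs ↭ y ∷ y ∷ zs × ys ↭ x ∷ zs)
∷∷-split p with ∷-split p
... | inj₁ q = inj₁ q
... | inj₂ (zs , q , r) with ∷-split r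
...   | inj₁ (refl , s) = inj₁ (refl , ↭-trans q (prep _ (↭-sym s)))
...   | inj₂ (ws , s , t) = inj₂ (ws , ↭-trans q (prep _ t) , s)

past : ∀ {a} {A : Set a} (xs ys : List A) {zs ws} → zs ↭ ys ++ ws → xs ++ zs ↭ ys ++ xs ++ ws
past xs ys p = ↭-trans (++⁺ˡ xs p) (shifts xs ys)

weaken : ∀ {Γ Θ Δ} Π → Θ ↭ Γ ++ Π → ⊢ Γ ⇒ Δ → ⊢ Θ ⇒ Δ
weaken Π q (Ax p) = Ax (↭-trans q (++⁺ʳ Π p))
weaken Π q (L⊥ p) = L⊥ (↭-trans q (++⁺ʳ Π p))
weaken Π q (R∧ d e) = R∧ (weaken Π q d) (weaken Π q e)
weaken Π q (L∧ p d) = L∧ (↭-trans q (++⁺ʳ Π p)) (weaken Π refl d)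
weaken Π q (R∨₀ d) = R∨₀ (weaken Π q d)
weaken Π q (R∨₁ d) = R∨₁ (weaken Π q d)
weaken Π q (L∨ p d e) = L∨ (↭-trans q (++⁺ʳ Π p)) (weaken Π refl d) (weaken Π refl e)
weaken Π q (R⊃ d) = R⊃ (weaken Π (prep _ q) d)
weaken Π q (L⊃ p d e) = L⊃ (↭-trans q (++⁺ʳ Π p)) (weaken Π refl d) (weaken Π refl e)
weaken Π q (R○ d) = R○ (weaken Π q d)
weaken Π q (L○ p d) = L○ (↭-trans q (++⁺ʳ Π p)) (weaken Π refl d)

exchange : ∀ {Γ Θ Δ} → Γ ↭ Θ → ⊢ Γ ⇒ Δ → ⊢ Θ ⇒ Δ
exchange {Γ} p = weaken [] (↭-trans (↭-sym p) (↭-reflexive (sym (++-identityʳ Γ))))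

-- φ ↝ Σ: an antecedent occurrence of φ may be replaced by Σ.  ○ φ ↝ [ φ ] is
-- admissible for every succedent, although L○ restricts it.
infix 4 _↝_
data _↝_ : Formula → Multiset → Set where
  ∧↝  : ∀ {φ ψ} → φ ∧ ψ ↝ φ ∷ ψ ∷ []
  ∨↝₀ : ∀ {φ ψ} → φ ∨ ψ ↝ [ φ ]
  ∨↝₁ : ∀ {φ ψ} → φ ∨ ψ ↝ [ ψ ]
  ⊃↝  : ∀ {φ ψ} → φ ⊃ ψ ↝ [ ψ ]
  ○↝  : ∀ {φ} → ○ φ ↝ [ φ ]

-- If `χ` is principal, a premise is already the wanted sequent; otherwise the last rule is
-- reapplied. The succedent never changes, so a reapplied `L○` stays legal.
invert : ∀ {χ Σ Π Γ Δ} → χ ↝ Σ → Π ↭ χ ∷ Γ → ⊢ Π ⇒ Δ → ⊢ Σ ++ Γ ⇒ Δ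
invert {χ} {Σ} i q (Ax p) with ∷-split (↭-trans (↭-sym p) q)
... | inj₁ (refl , _) with () ← i
... | inj₂ (_ , _ , s) = Ax (past Σ [ _ ] s)
invert {χ} {Σ} i q (L⊥ p) with ∷-split (↭-trans (↭-sym p) q)
... | inj₁ (refl , _) with () ← i
... | inj₂ (_ , _ , s) = L⊥ (past Σ [ _ ] s)
invert i q (R∧ d e) = R∧ (invert i q d) (invert i q e)
invert {χ} {Σ} i q (L∧ {φ = φ} {ψ} p d) with ∷-split (↭-trans (↭-sym p) q)
... | inj₁ (refl , r) with ∧↝ ← i = exchange (prep φ (prep ψ r)) d
... | inj₂ (_ , r , s) =
  L∧ (past Σ [ _ ] s)
     (exchange (shifts Σ (φ ∷ ψ ∷ [])) (invert i (past (φ ∷ ψ ∷ []) [ χ ] r) d))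
invert i q (R∨₀ d) = R∨₀ (invert i q d)
invert i q (R∨₁ d) = R∨₁ (invert i q d)
invert {χ} {Σ} i q (L∨ {φ = φ} {ψ} p d e) with ∷-split (↭-trans (↭-sym p) q)
invert {χ} {Σ} i q (L∨ {φ = φ} {ψ} p d e) | inj₁ (refl , r) with i
... | ∨↝₀ = exchange (prep φ r) d
... | ∨↝₁ = exchange (prep ψ r) e
invert {χ} {Σ} i q (L∨ {φ = φ} {ψ} p d e) | inj₂ (_ , r , s) =
  L∨ (past Σ [ _ ] s)
     (exchange (shifts Σ [ φ ]) (invert i (past [ φ ] [ χ ] r) d))
     (exchange (shifts Σ [ ψ ]) (invert i (past [ ψ ] [ χ ] r) e))
invert {χ} {Σ} i q (R⊃ {φ = φ} d) =
  R⊃ (exchange (shifts Σ [ φ ]) (invert i (past [ φ ] [ χ ] q) d))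
invert {χ} {Σ} i q (L⊃ {φ = φ} {ψ} p d e) with ∷-split (↭-trans (↭-sym p) q)
... | inj₁ (refl , r) with ⊃↝ ← i = exchange (prep ψ r) e
... | inj₂ (_ , r , s) =
  L⊃ (past Σ [ _ ] s)
     (exchange (shifts Σ [ φ ⊃ ψ ]) (invert i (past [ φ ⊃ ψ ] [ χ ] r) d))
     (exchange (shifts Σ [ ψ ]) (invert i (past [ ψ ] [ χ ] r) e))
invert i q (R○ d) = R○ (invert i q d)
invert {χ} {Σ} i q (L○ {ψ = ψ} p d) with ∷-split (↭-trans (↭-sym p) q)
... | inj₁ (refl , r) with ○↝ ← i = exchange (prep ψ r) d
... | inj₂ (_ , r , s) =
  L○ (past Σ [ _ ] s) (exchange (shifts Σ [ ψ ]) (invert i (past [ ψ ] [ χ ] r) d))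

contract : ∀ χ {Π Γ Δ} → Π ↭ χ ∷ χ ∷ Γ → ⊢ Π ⇒ Δ → ⊢ χ ∷ Γ ⇒ Δ
contract χ q (Ax p) with ∷∷-split (↭-trans (↭-sym p) q)
... | inj₁ (refl , _) = Ax refl
... | inj₂ (_ , _ , s) = Ax (past [ χ ] [ _ ] s)
contract χ q (L⊥ p) with ∷∷-split (↭-trans (↭-sym p) q)
... | inj₁ (refl , _) = L⊥ refl
... | inj₂ (_ , _ , s) = L⊥ (past [ χ ] [ _ ] s)
contract χ q (R∧ d e) = R∧ (contract χ q d) (contract χ q e)
contract χ q (L∧ {φ = φ} {ψ} p d) with ∷∷-split (↭-trans (↭-sym p) q)
... | inj₁ (refl , r) =
  L∧ refl (exchange (swap ψ φ refl)
    (contract ψ (shifts [ φ ] (ψ ∷ ψ ∷ []))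
      (contract φ (prep φ (swap ψ φ refl))
        (invert ∧↝ (past (φ ∷ ψ ∷ []) [ _ ] r) d))))
... | inj₂ (_ , r , s) =
  L∧ (past [ χ ] [ _ ] s)
     (exchange (shifts [ χ ] (φ ∷ ψ ∷ []))
       (contract χ (past (φ ∷ ψ ∷ []) (χ ∷ χ ∷ []) r) d))
contract χ q (R∨₀ d) = R∨₀ (contract χ q d)
contract χ q (R∨₁ d) = R∨₁ (contract χ q d)
contract χ q (L∨ {φ = φ} {ψ} p d e) with ∷∷-split (↭-trans (↭-sym p) q)
... | inj₁ (refl , r) =
  L∨ refl (contract φ refl (invert ∨↝₀ (past [ φ ] [ _ ] r) d))
          (contract ψ refl (invert ∨↝₁ (past [ ψ ] [ _ ] r) e))
... | inj₂ (_ , r , s) =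
  L∨ (past [ χ ] [ _ ] s)
     (exchange (shifts [ χ ] [ φ ]) (contract χ (past [ φ ] (χ ∷ χ ∷ []) r) d))
     (exchange (shifts [ χ ] [ ψ ]) (contract χ (past [ ψ ] (χ ∷ χ ∷ []) r) e))
contract χ q (R⊃ {φ = φ} d) =
  R⊃ (exchange (shifts [ χ ] [ φ ]) (contract χ (past [ φ ] (χ ∷ χ ∷ []) q) d))
contract χ q (L⊃ {φ = φ} {ψ} p d e) with ∷∷-split (↭-trans (↭-sym p) q)
... | inj₁ (refl , r) =
  -- The first premise retains the implication, so both copies are still there: same formula,
  -- smaller derivation. Only the second premise needs inversion.
  L⊃ refl (contract χ (prep _ r) d)
          (contract ψ refl (invert ⊃↝ (past [ ψ ] [ _ ] r) e))
... | inj₂ (_ , r , s) =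
  L⊃ (past [ χ ] [ _ ] s)
     (exchange (shifts [ χ ] [ φ ⊃ ψ ]) (contract χ (past [ φ ⊃ ψ ] (χ ∷ χ ∷ []) r) d))
     (exchange (shifts [ χ ] [ ψ ]) (contract χ (past [ ψ ] (χ ∷ χ ∷ []) r) e))
contract χ q (R○ d) = R○ (contract χ q d)
contract χ q (L○ {ψ = ψ} p d) with ∷∷-split (↭-trans (↭-sym p) q)
... | inj₁ (refl , r) =
  L○ refl (contract ψ refl (invert ○↝ (past [ ψ ] [ _ ] r) d))
... | inj₂ (_ , r , s) =
  L○ (past [ χ ] [ _ ] s)
     (exchange (shifts [ χ ] [ ψ ]) (contract χ (past [ ψ ] (χ ∷ χ ∷ []) r) d))

-- Once the head is contracted, its remaining copy is moved into the side context, which restores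
-- the shape for the tail.
contract-++ : ∀ Σ {Γ Δ} → ⊢ Σ ++ Σ ++ Γ ⇒ Δ → ⊢ Σ ++ Γ ⇒ Δ
contract-++ [] d = d
contract-++ (χ ∷ Σ) {Γ} d =
  exchange (shift χ Σ Γ)
    (contract-++ Σ
      (exchange (↭-sym (past Σ [ χ ] (shift χ Σ Γ)))
        (contract χ (prep χ (shift χ Σ (Σ ++ Γ))) d)))

-- Derivations that end neither in an axiom nor in a rule permutable below an
-- arbitrary cut on the succedent.
data Stuck : ∀ {Γ φ} → ⊢ Γ ⇒ just φ → Set where
  r∧  : ∀ {Γ φ ψ} {d : ⊢ Γ ⇒ just φ} {e : ⊢ Γ ⇒ just ψ} → Stuck (R∧ d e)
  r∨₀ : ∀ {Γ φ ψ} {d : ⊢ Γ ⇒ just φ} → Stuck (R∨₀ {ψ = ψ} d)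
  r∨₁ : ∀ {Γ φ ψ} {d : ⊢ Γ ⇒ just ψ} → Stuck (R∨₁ {φ = φ} d)
  r⊃  : ∀ {Γ φ ψ} {d : ⊢ φ ∷ Γ ⇒ just ψ} → Stuck (R⊃ d)
  r○  : ∀ {Γ φ} {d : ⊢ Γ ⇒ just φ} → Stuck (R○ d)
  l○  : ∀ {Θ Γ φ ψ} {p : Θ ↭ ○ ψ ∷ Γ} {d : ⊢ ψ ∷ Γ ⇒ just (○ φ)} → Stuck (L○ p d)

-- The permutation is a separate argument so that premises can be passed on as they stand; applying
-- `exchange` to them would lose structural descent.
cut : ∀ χ {Γ₁ Γ₂ Π Δ} → ⊢ Γ₁ ⇒ just χ → ⊢ Π ⇒ Δ → Π ↭ χ ∷ Γ₂ → ⊢ Γ₁ ++ Γ₂ ⇒ Δ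

cut-stuck : ∀ χ {Γ₁ Γ₂ Π Δ} (c : ⊢ Γ₁ ⇒ just χ) → Stuck c →
            ⊢ Π ⇒ Δ → Π ↭ χ ∷ Γ₂ → ⊢ Γ₁ ++ Γ₂ ⇒ Δ

-- The cut formula already occurs in the left antecedent, so weakening the right derivation
-- suffices.
cut χ {Γ₂ = Γ₂} (Ax {Γ = Γ} p) e q =
  weaken Γ (↭-trans (++⁺ʳ Γ₂ p) (↭-trans (prep χ (++-comm Γ Γ₂)) (++⁺ʳ Γ (↭-sym q)))) e
cut χ {Γ₂ = Γ₂} (L⊥ p) e q = L⊥ (++⁺ʳ Γ₂ p)
cut χ {Γ₂ = Γ₂} (L∧ p d) e q = L∧ (++⁺ʳ Γ₂ p) (cut χ d e q)
cut χ {Γ₂ = Γ₂} (L∨ p d d′) e q = L∨ (++⁺ʳ Γ₂ p) (cut χ d e q) (cut χ d′ e q)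
-- The succedent of `d` is not the cut formula, so `d` is weakened rather than cut.
cut χ {Γ₂ = Γ₂} (L⊃ p d d′) e q = L⊃ (++⁺ʳ Γ₂ p) (weaken Γ₂ refl d) (cut χ d′ e q)
cut χ c@(R∧ _ _) e q = cut-stuck χ c r∧ e q
cut χ c@(R∨₀ _) e q = cut-stuck χ c r∨₀ e q
cut χ c@(R∨₁ _) e q = cut-stuck χ c r∨₁ e q
cut χ c@(R⊃ _) e q = cut-stuck χ c r⊃ e q
cut χ c@(R○ _) e q = cut-stuck χ c r○ e q
cut χ c@(L○ _ _) e q = cut-stuck χ c l○ e q

cut-stuck χ {Γ₁} c v (Ax p) q with ∷-split (↭-trans (↭-sym p) q)
-- No `Stuck` derivation has an atom as succedent, nor `⊥ᶠ` in the case of `L⊥`.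
cut-stuck χ {Γ₁} c () (Ax p) q | inj₁ (refl , _)
... | inj₂ (_ , _ , s) = Ax (past Γ₁ [ _ ] s)
cut-stuck χ {Γ₁} c v (L⊥ p) q with ∷-split (↭-trans (↭-sym p) q)
cut-stuck χ {Γ₁} c () (L⊥ p) q | inj₁ (refl , _)
... | inj₂ (_ , _ , s) = L⊥ (past Γ₁ [ _ ] s)
cut-stuck χ c v (R∧ d e) q = R∧ (cut χ c d q) (cut χ c e q)
cut-stuck χ {Γ₁} c v (L∧ {φ = φ} {ψ} p d) q with ∷-split (↭-trans (↭-sym p) q)
cut-stuck (φ ∧ ψ) {Γ₁} (R∧ c₁ c₂) r∧ (L∧ p d) q | inj₁ (refl , r) =
  -- Each of the two smaller cuts contributes a copy of `Γ₁`.
  contract-++ Γ₁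
    (cut ψ c₂ (cut φ c₁ d (prep φ (prep ψ r))) (shift ψ Γ₁ _))
... | inj₂ (_ , r , s) =
  L∧ (past Γ₁ [ _ ] s)
     (exchange (shifts Γ₁ (φ ∷ ψ ∷ [])) (cut χ c d (past (φ ∷ ψ ∷ []) [ χ ] r)))
cut-stuck χ c v (R∨₀ d) q = R∨₀ (cut χ c d q)
cut-stuck χ c v (R∨₁ d) q = R∨₁ (cut χ c d q)
cut-stuck χ {Γ₁} c v (L∨ {φ = φ} {ψ} p d e) q with ∷-split (↭-trans (↭-sym p) q)
cut-stuck (φ ∨ ψ) (R∨₀ c) r∨₀ (L∨ p d e) q | inj₁ (refl , r) = cut φ c d (prep φ r)
cut-stuck (φ ∨ ψ) (R∨₁ c) r∨₁ (L∨ p d e) q | inj₁ (refl , r) = cut ψ c e (prep ψ r)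
... | inj₂ (_ , r , s) =
  L∨ (past Γ₁ [ _ ] s)
     (exchange (shifts Γ₁ [ φ ]) (cut χ c d (past [ φ ] [ χ ] r)))
     (exchange (shifts Γ₁ [ ψ ]) (cut χ c e (past [ ψ ] [ χ ] r)))
cut-stuck χ {Γ₁} c v (R⊃ {φ = φ} d) q =
  R⊃ (exchange (shifts Γ₁ [ φ ]) (cut χ c d (past [ φ ] [ χ ] q)))
cut-stuck χ {Γ₁} {Γ₂} c v (L⊃ {φ = φ} {ψ} p d e) q with ∷-split (↭-trans (↭-sym p) q)
cut-stuck (φ ⊃ ψ) {Γ₁} {Γ₂} (R⊃ c) r⊃ (L⊃ p d e) q | inj₁ (refl , r) =
  -- The innermost cut keeps the cut formula but has the smaller right derivation `d`; it removes
  -- the implication retained there. The cuts on `φ` and `ψ` then leave `Γ₁` and `Γ₂` twice each.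
  exchange (↭-reflexive (++-identityʳ (Γ₁ ++ Γ₂)))
    (contract-++ (Γ₁ ++ Γ₂) {[]}
      (exchange duplicated
        (cut ψ (cut φ (cut (φ ⊃ ψ) (R⊃ c) d (prep _ r)) c refl) e (prep ψ r))))
  where
  duplicated : ((Γ₁ ++ Γ₂) ++ Γ₁) ++ Γ₂ ↭ (Γ₁ ++ Γ₂) ++ (Γ₁ ++ Γ₂) ++ []
  duplicated rewrite ++-identityʳ (Γ₁ ++ Γ₂) = ↭-reflexive (++-assoc (Γ₁ ++ Γ₂) Γ₁ Γ₂)
... | inj₂ (_ , r , s) =
  L⊃ (past Γ₁ [ _ ] s)
     (exchange (shifts Γ₁ [ φ ⊃ ψ ]) (cut χ c d (past [ φ ⊃ ψ ] [ χ ] r)))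
     (exchange (shifts Γ₁ [ ψ ]) (cut χ c e (past [ ψ ] [ χ ] r)))
cut-stuck χ c v (R○ d) q = R○ (cut χ c d q)
cut-stuck χ {Γ₁} c v (L○ {ψ = ψ} p d) q with ∷-split (↭-trans (↭-sym p) q)
cut-stuck (○ ψ) (R○ c) r○ (L○ p d) q | inj₁ (refl , r) = cut ψ c d (prep ψ r)
cut-stuck (○ ψ) {Γ₂ = Γ₂} (L○ p′ c) l○ e@(L○ p d) q | inj₁ (refl , r) =
  -- Here `e` stays whole and the left derivation shrinks.
  L○ (++⁺ʳ Γ₂ p′) (cut (○ ψ) c e q)
... | inj₂ (_ , r , s) =
  L○ (past Γ₁ [ _ ] s) (exchange (shifts Γ₁ [ ψ ]) (cut χ c d (past [ ψ ] [ χ ] r)))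

mainTheorem1 : (Γ₁ Γ₂ : Multiset) (φ : Formula) (Δ : Succedent) →
    ⊢ Γ₁ ⇒ just φ →
    ⊢ φ ∷ Γ₂ ⇒ Δ →
    ⊢ Γ₁ ++ Γ₂ ⇒ Δ
mainTheorem1 Γ₁ Γ₂ φ Δ d e = cut φ d e refl
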